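{- TreeRes does not simulate MaxRes, and TreeRes does not simulate MaxResW.
   Context: A proof system $P$ simulates a proof system $P'$ if there is a polynomial $p$ such that every unsatisfiable CNF formula $F$ having a $P'$-refutation of size $s$ has a $P$-refutation of size at most $p(s+|F|)$, where $|F|$ is the size of $F$. Clauses are disjunctions of sets of literals with no complementary pair. $\Box$ is the empty clause. TreeRes (tree-like resolution): refutations using the resolution rule (from $C\vee x$ and $D\vee\overline{x}$ infer $C\vee D$), and optionally the weakening rule (from $C$ infer $C\vee x$), deriving $\Box$ from the clauses of $F$, where the underlying derivation graph is a tree. The size is the number of clauses (nodes) in the tree. MaxSAT resolution rule: from $x\vee A$ and $\overline{x}\vee B$ with $A=a_1\vee\dots\vee a_s$, $B=b_1\vee\dots\vee b_t$, derive $A\vee B$; the clauses $x\vee A\vee b_1\vee\dots\vee b_{j-1}\vee\overline{b_j}$ for $1\le j\le t$; and the clauses $\overline{x}\vee B\vee a_1\vee\dots\vee a_{j-1}\vee\overline{a_j}$ for $1\le j\le s$. MaxSAT weakening rule: replace a clause $A$ by the two clauses $A\vee x$ and $A\vee\overline{x}$. When a rule is applied to a multi-set of clauses, (one copy of) each antecedent is removed and all non-tautologous consequents are added. A MaxRes refutation of $F$ is a sequence of multi-sets $F=F_0,\dots,F_s$, each obtained from the previous one by one application of the MaxSAT resolution rule, with $\Box\in F_s$; its size is $s$. MaxResW is the same except that the MaxSAT weakening rule may also be used. -}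

module Defs where

open import Data.Bool.Base using (Bool; true; false; not)
import Data.Bool.Properties as Bool
open import Data.List.Base
  using (List; []; _∷_; _++_; map; sum; length; foldr; filter; deduplicate)
open import Data.List.Membership.Propositional using (_∈_; _∉_)
import Data.List.Membership.DecPropositional as DecMembership
open import Data.List.Relation.Binary.BagAndSetEquality
  using (set; _∼[_]_; [_]-Equality)
import Data.List.Relation.Binary.Permutation.Setoid as SetoidPermutation
open import Data.List.Relation.Unary.All using (All)
open import Data.List.Relation.Unary.Any using (Any; any?)
import Data.List.Relation.Unary.Unique.Setoid as SetoidUnique
open import Data.Nat.Base using (ℕ; zero; suc; _+_; _*_; _≤_)
import Data.Nat.Properties as ℕ
open import Data.Product.Base using (_×_; _,_; ∃-syntax)
open import Data.Product.Properties using (≡-dec)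
open import Level using (0ℓ)
open import Relation.Binary.Core using (Rel)
open import Relation.Binary.Construct.Union using (_∪_)
open import Relation.Binary.Definitions using (DecidableEquality)
open import Relation.Binary.PropositionalEquality.Core using (_≡_)
open import Relation.Nullary.Decidable.Core using (Dec; ¬?)
open import Relation.Nullary.Negation.Core using (¬_)

Var : Set
Var = ℕ

Literal : Set
Literal = Var × Bool

pattern pos x = x , true
pattern neg x = x , false

complement : Literal → Literal
complement (x , b) = x , not b

_≟ˡ_ : DecidableEquality Literal
_≟ˡ_ = ≡-dec ℕ._≟_ Bool._≟_

open DecMembership _≟ˡ_ using (_∈?_)

-- A list of literals stands for the set of its members: order and repetition
-- are immaterial, and two lists are identified when they are equal as sets.
-- In particular C ++ D is C ∨ D, and [] is the empty clause □.
Disjunction : Set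
Disjunction = List Literal

Tautologous : Disjunction → Set
Tautologous C = Any (λ l → complement l ∈ C) C

tautologous? : ∀ C → Dec (Tautologous C)
tautologous? C = any? (λ l → complement l ∈? C) C

IsClause : Disjunction → Set
IsClause C = ¬ Tautologous C

isClause? : ∀ C → Dec (IsClause C)
isClause? C = ¬? (tautologous? C)

width : Disjunction → ℕ
width C = length (deduplicate _≟ˡ_ C)

MultiSet : Set
MultiSet = List Disjunction

-- Equality of multi-sets of clauses: a permutation that matches clauses which
-- are equal as sets.
open SetoidPermutation ([ set ]-Equality Literal) public using (_↭_)
open SetoidUnique ([ set ]-Equality Literal) public using (Unique)

-- A CNF formula is a finite set of clauses, so no clause is listed twice.
record CNF : Set where
  field
    clauses    : List Disjunction
    areClauses : All IsClause clauses
    distinct   : Unique clauses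

open CNF public

-- The number of clauses plus the number of occurrences of literals.
∣_∣ : CNF → ℕ
∣ F ∣ = sum (map (λ C → suc (width C)) (clauses F))

Assignment : Set
Assignment = Var → Bool

_⊨ˡ_ : Assignment → Literal → Set
α ⊨ˡ (x , b) = α x ≡ b

_⊨_ : Assignment → CNF → Set
α ⊨ F = All (Any (α ⊨ˡ_)) (clauses F)

Unsatisfiable : CNF → Set
Unsatisfiable F = ∀ α → ¬ (α ⊨ F)

-- P F s means that F has a P-refutation of size s.
ProofSystem : Set₁
ProofSystem = CNF → ℕ → Set

-- Coefficients, constant term first.  Natural coefficients suffice for bounds:
-- every polynomial is dominated on ℕ by one of these.
Polynomial : Set
Polynomial = List ℕ

eval : Polynomial → ℕ → ℕ
eval p n = foldr (λ a r → a + n * r) 0 p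

_Simulates_ : ProofSystem → ProofSystem → Set
P Simulates P′ =
  ∃[ p ] ∀ F → Unsatisfiable F → ∀ s → P′ F s →
    ∃[ t ] t ≤ eval p (s + ∣ F ∣) × P F t

infix 4 _Simulates_

-- Replacing premises by equal sets of literals is not a proof step, so the set
-- equalities are side conditions of the rules.
data _⊢_ (F : CNF) : Disjunction → Set where
  axiom   : ∀ {C} → C ∈ clauses F → F ⊢ C
  resolve : ∀ {P Q} x C D →
            P ∼[ set ] (pos x ∷ C) → pos x ∉ C →
            Q ∼[ set ] (neg x ∷ D) → neg x ∉ D →
            IsClause (C ++ D) →
            F ⊢ P → F ⊢ Q → F ⊢ (C ++ D)
  weaken  : ∀ {C} l → IsClause (l ∷ C) → F ⊢ C → F ⊢ (l ∷ C)

infix 4 _⊢_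

nodes : ∀ {F C} → F ⊢ C → ℕ
nodes (axiom _)                     = 1
nodes (resolve _ _ _ _ _ _ _ _ π ρ) = suc (nodes π + nodes ρ)
nodes (weaken _ _ π)                = suc (nodes π)

TreeRes : ProofSystem
TreeRes F s = ∃[ π ] nodes {F} {[]} π ≡ s

-- chain P (b₁ ∷ … ∷ bₜ ∷ []) lists P ∨ b₁ ∨ … ∨ bⱼ₋₁ ∨ b̄ⱼ for 1 ≤ j ≤ t.
-- A repeated bⱼ only contributes a tautology.
chain : Disjunction → List Literal → List Disjunction
chain P []       = []
chain P (b ∷ bs) = (complement b ∷ P) ∷ chain (b ∷ P) bs

consequents : Var → Disjunction → Disjunction → List Disjunction
consequents x A B = (A ++ B) ∷ chain (pos x ∷ A) B ++ chain (neg x ∷ B) A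

-- The lists A and B are arbitrary enumerations of the side literals, so the
-- orders a₁, …, aₛ and b₁, …, bₜ are free choices; R is the untouched rest.
data MaxResolution (F G : MultiSet) : Set where
  maxResolve : ∀ x A B R → pos x ∉ A → neg x ∉ B →
               F ↭ (pos x ∷ A) ∷ (neg x ∷ B) ∷ R →
               G ↭ filter isClause? (consequents x A B) ++ R →
               MaxResolution F G

data MaxWeakening (F G : MultiSet) : Set where
  maxWeaken : ∀ x A R →
              F ↭ A ∷ R →
              G ↭ filter isClause? ((pos x ∷ A) ∷ (neg x ∷ A) ∷ []) ++ R →
              MaxWeakening F G

-- Refutation Step F s: a sequence F = F₀, …, Fₛ of Steps with □ ∈ Fₛ.
data Refutation (Step : Rel MultiSet 0ℓ) (F : MultiSet) : ℕ → Set where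
  done : [] ∈ F → Refutation Step F zero
  step : ∀ {G s} → Step F G → Refutation Step G s → Refutation Step F (suc s)

MaxRes : ProofSystem
MaxRes F = Refutation MaxResolution (clauses F)

MaxResW : ProofSystem
MaxResW F = Refutation (MaxResolution ∪ MaxWeakening) (clauses F)

{-# OPTIONS --safe #-}
module Submission where

-- The formulas speak about nodes (i , a) with a ≤ i ≤ L.  An active node (i , a) activates
-- (i + 1 , a) or (i + 1 , a + 1), according to a switch xᵢ shared by the whole layer i; (0 , 0) is
-- active and no node of layer L is.  Each node carries two variables and is active when both are
-- true.
--
-- MaxRes is efficient because, for each value of xᵢ, layer i is mapped injectively to layer i + 1:
-- the clause saying that (i + 1 , b) is inactive has two possible predecessors, but they need it for
-- opposite values of xᵢ, and the clause left over by the first use is what the second one consumes.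
--
-- TreeRes needs 2 ^ (L − 1) nodes, by an adversary answering queries to variables.  It keeps a path
-- of active nodes down to some depth ℓ and declares all others inactive.  The first query to a
-- switch or node below ℓ may be answered freely, which doubles the tree.  Without touched items the
-- number of nodes reachable from the end of the path grows by one per layer, and each touched item
-- costs at most one; so while at most e items are touched in the first e layers below ℓ, for all e,
-- the path can be prolonged.  When a query would violate this for some e, the path is prolonged by e
-- layers first, which uses up e touched items.

open import Defs
import Algebra.Solver.CommutativeMonoid as CommutativeMonoidSolver
open import Data.Bool.Base using (Bool; true; false; not; _∨_; if_then_else_)
open import Data.Bool.Properties using (not-involutive; not-injective; not-¬)
  renaming (_≟_ to _≟ᵇ_)
open import Data.List.Base using (List; []; _∷_; _++_; [_]; map; length; filter)
import Data.List.Membership.DecPropositional as DecMembership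
open import Data.List.Membership.Propositional using (_∈_; _∉_; find; lose)
open import Data.List.Membership.Propositional.Properties
  using (∈-filter⁺; ∈-filter⁻; ∈-map⁺; ∈-map⁻; ∈-++⁺ˡ; ∈-++⁺ʳ)
open import Data.List.Properties
  using (length-map; length-++; length-deduplicate; map-++; ++-identityʳ;
         filter-all; filter-accept; filter-reject; filter-++)
open import Data.List.Relation.Binary.BagAndSetEquality
  using (set; _∼[_]_; [_]-Equality; ++-idempotent)
import Data.List.Relation.Binary.Permutation.Setoid as SetoidPermutation
import Data.List.Relation.Binary.Permutation.Setoid.Properties as SetoidPermutationProperties
open import Data.List.Relation.Unary.All as All using (All; []; _∷_)
import Data.List.Relation.Unary.All.Properties as All
open import Data.List.Relation.Unary.AllPairs as AllPairs using (AllPairs; []; _∷_)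
import Data.List.Relation.Unary.AllPairs.Properties as AllPairs
open import Data.List.Relation.Unary.Any as Any using (Any; here; there)
open import Data.Nat.Base
open import Data.Nat.ListAction using (sum)
open import Data.Nat.Properties
open import Data.Nat.Tactic.RingSolver using (solve-∀)
open import Data.Product.Base using (Σ; ∃-syntax; _×_; _,_; proj₁; proj₂)
open import Data.Sum.Base using (_⊎_; inj₁; inj₂)
open import Function.Base using (_∘_; id)
open import Function.Bundles using (Equivalence; mk⇔)
open import Relation.Binary.Bundles using (Setoid)
open import Relation.Binary.PropositionalEquality hiding ([_])
open import Relation.Nullary.Decidable
  using (Dec; yes; no; does; toSum; ¬?; _×-dec_; dec-true; dec-false; map′)
open import Relation.Nullary.Negation using (¬_; contradiction)

module ∼ = Setoid ([ set ]-Equality Literal)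
open SetoidPermutation ([ set ]-Equality Literal)
  using (prep; ↭-swap; ↭-trans; ↭-sym; ↭-refl; ↭-reflexive)
open SetoidPermutationProperties ([ set ]-Equality Literal)
  using (++-commutativeMonoid; shifts; ∈-resp-↭; ++⁺ʳ)
open CommutativeMonoidSolver ++-commutativeMonoid using (solve; _⊜_; _⊕_)

-- Variables of the formulas and their numbering

-- half k i a, for k = false and true, are the two variables of node (i , a).
data Variable : Set where
  switch : ℕ → Variable
  half   : Bool → ℕ → ℕ → Variable

next : ℕ × ℕ → ℕ × ℕ
next (zero  , b) = suc b , zero
next (suc a , b) = a , suc b

-- The inverse of Cantor's pairing function, walking along one antidiagonal after another.
unpair : ℕ → ℕ × ℕ
unpair zero    = zero , zero
unpair (suc n) = next (unpair n)

-- Recursion along the antidiagonal a + b = s, which next traverses downwards.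
unpair-diagonal : ∀ s b → b ≤ s → ∃[ n ] unpair n ≡ (s ∸ b , b)
unpair-diagonal zero    zero    _   = 0 , refl
unpair-diagonal (suc s) zero    _   with unpair-diagonal s s ≤-refl
... | n , eq = suc n , trans (cong next eq) (cong (λ a → next (a , s)) (n∸n≡0 s))
unpair-diagonal s       (suc b) b<s with unpair-diagonal s b (<⇒≤ b<s)
... | n , eq = suc n , trans (cong next eq)
  (cong (λ a → next (a , b)) (+-∸-assoc 1 {s} {suc b} b<s))

unpair-surjective : ∀ a b → ∃[ n ] unpair n ≡ (a , b)
unpair-surjective a b with unpair-diagonal (a + b) b (m≤n+m b a)
... | n , eq = n , trans eq (cong (_, b) (m+n∸n≡m a b))

fromPair : ℕ × ℕ → Variable
fromPair (0           , n) = switch n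
fromPair (1           , n) = half false (proj₁ (unpair n)) (proj₂ (unpair n))
fromPair (suc (suc _) , n) = half true  (proj₁ (unpair n)) (proj₂ (unpair n))

decode : Var → Variable
decode n = fromPair (unpair n)

decode-surjective : ∀ v → ∃[ n ] decode n ≡ v
decode-surjective (switch j) with unpair-surjective 0 j
... | n , eq = n , cong fromPair eq
decode-surjective (half k i a) with unpair-surjective i a
decode-surjective (half false i a) | m , eq′ with unpair-surjective 1 m
... | n , eq = n , trans (cong fromPair eq) (cong (λ p → half false (proj₁ p) (proj₂ p)) eq′)
decode-surjective (half true i a) | m , eq′ with unpair-surjective 2 m
... | n , eq = n , trans (cong fromPair eq) (cong (λ p → half true (proj₁ p) (proj₂ p)) eq′)

-- A choice of preimages under the surjection `decode` is an injective numbering. It is sealed so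
-- that type checking never computes codes; `decode-code` carries all that is used about them.
abstract
  code : Variable → Var
  code v = proj₁ (decode-surjective v)

  decode-code : ∀ v → decode (code v) ≡ v
  decode-code v = proj₂ (decode-surjective v)

code-injective : ∀ {v w} → code v ≡ code w → v ≡ w
code-injective {v} {w} eq = trans (sym (decode-code v)) (trans (cong decode eq) (decode-code w))

_≟ᵛ_ : (v w : Variable) → Dec (v ≡ w)
switch i   ≟ᵛ switch j     = map′ (cong switch) (λ { refl → refl }) (i ≟ j)
switch _   ≟ᵛ half _ _ _   = no λ ()
half _ _ _ ≟ᵛ switch _     = no λ ()
half k i a ≟ᵛ half k′ j b  =
  map′ (λ { (refl , refl , refl) → refl }) (λ { refl → refl , refl , refl })
       (k ≟ᵇ k′ ×-dec i ≟ j ×-dec a ≟ b)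

-- The axioms of the formulas

shift : Bool → ℕ → ℕ
shift false a = a
shift true  a = suc a

-- edge i a c k: if (i , a) is active and switch i has value c, half k holds at its successor.
data Axiom : Set where
  start : Bool → Axiom
  edge  : ℕ → ℕ → Bool → Bool → Axiom
  end   : ℕ → ℕ → Axiom

literals : Axiom → List (Variable × Bool)
literals (start k)      = (half k 0 0 , true) ∷ []
literals (edge i a c k) =
  (switch i , not c) ∷ (half false i a , false) ∷ (half true i a , false) ∷
  (half k (suc i) (shift c a) , true) ∷ []
literals (end i a)      = (half false i a , false) ∷ (half true i a , false) ∷ []

encode : Variable × Bool → Literal
encode (v , b) = code v , b

clause : Axiom → Disjunction
clause = map encode ∘ literals

-- Larger columns come first, because `row` consumes a layer from right to left.
edges : ℕ → ℕ → List Axiom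
edges i zero    = []
edges i (suc n) =
  edge i n true false ∷ edge i n true true ∷ edge i n false false ∷ edge i n false true ∷ edges i n

ends : ℕ → ℕ → List Axiom
ends i zero    = []
ends i (suc n) = end i n ∷ ends i n

above : ℕ → List Axiom
above zero    = start false ∷ start true ∷ []
above (suc i) = edges i (suc i) ++ above i

axioms : ℕ → List Axiom
axioms L = ends L (suc L) ++ above L

data Occurs (L : ℕ) : Axiom → Set where
  start : ∀ {k} → Occurs L (start k)
  edge  : ∀ {i a c k} → i < L → Occurs L (edge i a c k)
  end   : ∀ {a} → Occurs L (end L a)

-- Counting touched items by height

-- A path of active nodes down to layer n has used the switches and nodes of height at most n.
height : Variable → ℕ
height (switch j)   = suc j
height (half _ i _) = i

-- Both halves of a node form one item: a touched node is settled as inactive, whichever half was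
-- queried.
item : Variable → Variable
item (switch j)   = switch j
item (half _ i a) = half false i a

height-item : ∀ v → height (item v) ≡ height v
height-item (switch _)   = refl
height-item (half _ _ _) = refl

position : (ℕ → Bool) → ℕ → ℕ
position d zero    = zero
position d (suc i) = shift (d i) (position d i)

position-cong : ∀ {d d′} i → (∀ j → j < i → d j ≡ d′ j) → position d i ≡ position d′ i
position-cong zero    _  = refl
position-cong (suc i) eq =
  cong₂ shift (eq i ≤-refl) (position-cong i λ j j<i → eq j (m<n⇒m<1+n j<i))

weight : ℕ → Variable → ℕ
weight n v = if does (height v ≤? n) then 1 else 0

load : ℕ → List Variable → ℕ
load n []      = 0
load n (v ∷ Z) = weight n v + load n Z

weight-in : ∀ {n} v → height v ≤ n → weight n v ≡ 1
weight-in {n} v h rewrite dec-true (height v ≤? n) h = refl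

weight-out : ∀ {n} v → n < height v → weight n v ≡ 0
weight-out {n} v h rewrite dec-false (height v ≤? n) (<⇒≱ h) = refl

weight≤1 : ∀ n v → weight n v ≤ 1
weight≤1 n v with n <? height v
... | yes n<h = ≤-trans (≤-reflexive (weight-out v n<h)) z≤n
... | no n≮h = ≤-reflexive (weight-in v (≮⇒≥ n≮h))

weight-mono : ∀ {m n} v → m ≤ n → weight m v ≤ weight n v
weight-mono {m} v m≤n with m <? height v
... | yes m<h = ≤-trans (≤-reflexive (weight-out v m<h)) z≤n
... | no m≮h = ≤-trans (weight≤1 m v) (≤-reflexive (sym (weight-in v (≤-trans (≮⇒≥ m≮h) m≤n))))

load≤length : ∀ n Z → load n Z ≤ length Z
load≤length n []      = z≤n
load≤length n (v ∷ Z) = +-mono-≤ (weight≤1 n v) (load≤length n Z)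

load-∈ : ∀ {n v Z} → v ∈ Z → height v ≤ n → 1 ≤ load n Z
load-∈ {n} {v} (here refl) h rewrite weight-in v h = s≤s z≤n
load-∈ {n} {v} {w ∷ Z} (there v∈) h = ≤-trans (load-∈ v∈ h) (m≤n+m _ (weight n w))

-- Serves to exclude two distinct touched items in the first layer below the path, where `room`
-- permits one.
load-∈₂ : ∀ {n v w Z} → v ∈ Z → w ∈ Z → v ≢ w → height v ≤ n → height w ≤ n → 2 ≤ load n Z
load-∈₂ (here refl) (here refl) v≢w _ _ = contradiction refl v≢w
load-∈₂ {v = v} (here refl) (there q) _ h h′ rewrite weight-in v h = s≤s (load-∈ q h′)
load-∈₂ {w = w} (there p) (here refl) _ h h′ rewrite weight-in w h′ = s≤s (load-∈ p h)
load-∈₂ {n} {Z = u ∷ Z} (there p) (there q) v≢w h h′ =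
  ≤-trans (load-∈₂ p q v≢w h h′) (m≤n+m _ (weight n u))

deeper : ℕ → List Variable → List Variable
deeper n = filter (λ v → n <? height v)

length-deeper : ∀ n Z → length (deeper n Z) + load n Z ≡ length Z
length-deeper n [] = refl
length-deeper n (v ∷ Z) with <-≤-connex n (height v)
... | inj₁ n<h rewrite dec-true (n <? height v) n<h | weight-out v n<h =
  cong suc (length-deeper n Z)
... | inj₂ h≤n rewrite dec-false (n <? height v) (≤⇒≯ h≤n) | weight-in v h≤n =
  trans (+-suc _ _) (cong suc (length-deeper n Z))

-- The items that `deeper m` drops have height at most m, hence at most n, so dropping them lowers
-- `load n` by `load m`.
load-deeper : ∀ {m n} Z → m ≤ n → load n (deeper m Z) + load m Z ≤ load n Z
load-deeper [] m≤n = z≤n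
load-deeper {m} {n} (v ∷ Z) m≤n with <-≤-connex m (height v)
... | inj₁ m<h rewrite dec-true (m <? height v) m<h | weight-out v m<h =
  ≤-trans (≤-reflexive (+-assoc (weight n v) _ _)) (+-monoʳ-≤ (weight n v) (load-deeper Z m≤n))
... | inj₂ h≤m rewrite dec-false (m <? height v) (≤⇒≯ h≤m)
      | weight-in v h≤m | weight-in v (≤-trans h≤m m≤n) =
  ≤-trans (≤-reflexive (+-suc _ _)) (s≤s (load-deeper Z m≤n))

-- Positions that avoid the touched nodes of a layer

Ascending : List ℕ → Set
Ascending = AllPairs _<_

length-remove : ∀ b {S} → Ascending S → length S ≤ suc (length (filter (λ a → ¬? (a ≟ b)) S))
length-remove b [] = z≤n
length-remove b {x ∷ S} (x< ∷ asc) = by-cases (x ≟ b)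
  where
  P? = λ a → ¬? (a ≟ b)
  by-cases : Dec (x ≡ b) → suc (length S) ≤ suc (length (filter P? (x ∷ S)))
  by-cases (yes refl) = s≤s (≤-reflexive (cong length (trans
    (sym (filter-all P? (All.map >⇒≢ x<))) (sym (filter-reject P? {xs = S} λ x≢x → x≢x refl)))))
  by-cases (no x≢b) = subst (λ T → suc (length S) ≤ suc (length T)) (sym (filter-accept P? x≢b))
    (s≤s (length-remove b asc))

-- The difference between `load (suc m) Z` and `load m Z` counts the items of height exactly
-- `suc m`. Each touched node among them removes at most one position, whence `count`. The item
-- `switch m` removes none, which yields the extra one of `count-switch`.
record Surviving (m : ℕ) (S : List ℕ) (Z : List Variable) : Set where
  field
    survivors : List ℕ
    ascending : Ascending survivors
    inherited : ∀ {a} → a ∈ survivors → a ∈ S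
    avoiding  : ∀ {a} → a ∈ survivors → half false (suc m) a ∉ Z
    count     : length S + load m Z ≤ length survivors + load (suc m) Z
    count-switch : switch m ∈ Z → suc (length S + load m Z) ≤ length survivors + load (suc m) Z
open Surviving

surviving : ∀ m S → Ascending S → ∀ Z → Surviving m S Z
surviving m S asc [] = record
  { survivors = S ; ascending = asc ; inherited = id ; avoiding = λ _ ()
  ; count = ≤-refl ; count-switch = λ () }
surviving m S asc (z ∷ Z) with surviving m S asc Z | height z ≟ suc m
... | T | no h≢ = record
  { survivors = survivors T ; ascending = ascending T ; inherited = inherited T
  ; avoiding = λ { a∈ (here refl) → h≢ refl ; a∈ (there p) → avoiding T a∈ p }
  ; count = bump (count T)
  ; count-switch = λ { (here refl) → contradiction refl h≢ ; (there p) → bump (count-switch T p) } }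
  where
  swap₊ : ∀ s w t → s + (w + t) ≡ w + (s + t)
  swap₊ s w t = trans (sym (+-assoc s w t)) (trans (cong (_+ t) (+-comm s w)) (+-assoc w s t))
  bump : ∀ {p s} → p + load m Z ≤ s + load (suc m) Z →
         p + load m (z ∷ Z) ≤ s + load (suc m) (z ∷ Z)
  bump {p} {s} le = begin
    p + (weight m z + load m Z)             ≡⟨ swap₊ p (weight m z) _ ⟩
    weight m z + (p + load m Z)             ≤⟨ +-mono-≤ (weight-mono {m} {suc m} z (n≤1+n m)) le ⟩
    weight (suc m) z + (s + load (suc m) Z) ≡⟨ swap₊ (weight (suc m) z) s _ ⟩
    s + (weight (suc m) z + load (suc m) Z) ∎
    where open ≤-Reasoning
surviving m S asc (switch .m ∷ Z) | T | yes refl = record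
  { survivors = survivors T ; ascending = ascending T ; inherited = inherited T
  ; avoiding = λ { a∈ (there p) → avoiding T a∈ p }
  ; count = <⇒≤ more
  ; count-switch = λ _ → more }
  where
  more : suc (length S + load m (switch m ∷ Z)) ≤
         length (survivors T) + load (suc m) (switch m ∷ Z)
  more rewrite weight-in {suc m} (switch m) ≤-refl | weight-out {m} (switch m) ≤-refl =
    ≤-trans (s≤s (count T)) (≤-reflexive (sym (+-suc _ _)))
surviving m S asc (half k .(suc m) b ∷ Z) | T | yes refl = record
  { survivors = kept
  ; ascending = AllPairs.filter⁺ _ (ascending T)
  ; inherited = λ a∈ → inherited T (proj₁ (∈-filter⁻ _ a∈))
  ; avoiding = λ
      { a∈ (here refl) → proj₂ (∈-filter⁻ (λ a → ¬? (a ≟ b)) {xs = survivors T} a∈) refl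
      ; a∈ (there p)   → avoiding T (proj₁ (∈-filter⁻ _ a∈)) p }
  ; count = drop-one (count T)
  ; count-switch = λ { (there p) → drop-one (count-switch T p) } }
  where
  kept = filter (λ a → ¬? (a ≟ b)) (survivors T)
  z = half k (suc m) b
  drop-one : ∀ {p} → p + load m Z ≤ length (survivors T) + load (suc m) Z →
             p + load m (z ∷ Z) ≤ length kept + load (suc m) (z ∷ Z)
  drop-one {p} le rewrite weight-in {suc m} z ≤-refl | weight-out {m} z ≤-refl = begin
    p + load m Z ≤⟨ le ⟩
    length (survivors T) + load (suc m) Z ≤⟨ +-monoˡ-≤ _ (length-remove b (ascending T)) ⟩
    suc (length kept + load (suc m) Z) ≡⟨ +-suc _ _ ⟨
    length kept + suc (load (suc m) Z) ∎
    where open ≤-Reasoning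

-- The adversary and its invariants

-- Everything below depth is inactive under α; r free answers are still guaranteed.
record Adversary (L r : ℕ) : Set where
  field
    α       : Variable → Bool
    depth   : ℕ
    touched : List Variable
  path : ℕ → ℕ
  path = position (α ∘ switch)
  field
    on     : ∀ {i} k → i ≤ depth → α (half k i (path i)) ≡ true
    off    : ∀ {i a} → α (half false i a) ≡ true → α (half true i a) ≡ true →
             i ≤ depth × a ≡ path i
    room   : ∀ e → load (depth + e) touched ≤ e
    budget : depth + length touched + r < L
  Known : Variable → Set
  Known v = height v ≤ depth ⊎ item v ∈ touched
open Adversary

-- Only known values persist; an unknown variable may change its value when the path is prolonged.
record _⊑_ {L r r′} (s : Adversary L r) (s′ : Adversary L r′) : Set where
  field
    value : ∀ {v} → Known s v → α s′ v ≡ α s v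
    known : ∀ {v} → Known s v → Known s′ v
open _⊑_

-- Prolonging the path

module _ {L r} (s : Adversary L r) where
  private
    ℓ = depth s
    Z = touched s

  -- The paths that may replace the current one. They obey the known switches, in particular all
  -- those above ℓ, and below ℓ they miss the touched nodes, which have to stay inactive.
  record Reaches (m a : ℕ) : Set where
    field
      turns  : ℕ → Bool
      agrees : ∀ {j} → Known s (switch j) → turns j ≡ α s (switch j)
      avoids : ∀ {i} → ℓ < i → i ≤ m → half false i (position turns i) ∉ Z
      ends-at : position turns m ≡ a
  open Reaches

  extend : ∀ {m a} c → ℓ ≤ m → (switch m ∈ Z → c ≡ α s (switch m)) → Reaches m a →
           half false (suc m) (shift c a) ∉ Z → Reaches (suc m) (shift c a)
  extend {m} {a} c ℓ≤m forced R free = record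
    { turns = t ; agrees = agr ; avoids = av ; ends-at = arrive }
    where
    t : ℕ → Bool
    t j = if does (j ≟ m) then c else turns R j
    t-new : t m ≡ c
    t-new rewrite dec-true (m ≟ m) refl = refl
    t-old : ∀ {j} → j ≢ m → t j ≡ turns R j
    t-old {j} j≢m rewrite dec-false (j ≟ m) j≢m = refl
    pos-old : ∀ {i} → i ≤ m → position t i ≡ position (turns R) i
    pos-old {i} i≤m = position-cong i λ j j<i → t-old (<⇒≢ (<-≤-trans j<i i≤m))
    arrive : position t (suc m) ≡ shift c a
    arrive = cong₂ shift t-new (trans (pos-old ≤-refl) (ends-at R))
    agr : ∀ {j} → Known s (switch j) → t j ≡ α s (switch j)
    agr {j} kn with j ≟ m
    ... | no j≢m = trans (t-old j≢m) (agrees R kn)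
    agr (inj₁ m<ℓ) | yes refl = contradiction ℓ≤m (<⇒≱ m<ℓ)
    agr (inj₂ m∈) | yes refl = trans t-new (forced m∈)
    av : ∀ {i} → ℓ < i → i ≤ suc m → half false i (position t i) ∉ Z
    av {i} ℓ<i i≤ with m≤n⇒m<n∨m≡n i≤
    ... | inj₁ (s≤s i≤m) = subst (λ a → half false i a ∉ Z) (sym (pos-old i≤m)) (avoids R ℓ<i i≤m)
    ... | inj₂ refl = subst (λ a → half false (suc m) a ∉ Z) (sym arrive) free

  -- `large` expresses that the front gains one position per layer and loses at most one per touched
  -- item. Together with `room` it makes the front at layer `ℓ + e` nonempty.
  record Front (m e : ℕ) : Set where
    field
      front      : List ℕ
      increasing : Ascending front
      reached    : ∀ {a} → a ∈ front → Reaches m a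
      large      : suc e ≤ length front + load m Z
  open Front

  shift-mono : ∀ c {a b} → a < b → shift c a < shift c b
  shift-mono false lt = lt
  shift-mono true  lt = s≤s lt

  -- Not every successor of S, but the least position unshifted and all positions shifted. For
  -- nonempty S these are one more than S has, and they stay strictly ascending.
  both-shifts : List ℕ → List ℕ
  both-shifts []      = []
  both-shifts (a ∷ S) = a ∷ map suc (a ∷ S)

  both-shifts-ascending : ∀ {S} → Ascending S → Ascending (both-shifts S)
  both-shifts-ascending [] = []
  both-shifts-ascending (a< ∷ asc) =
    All.map⁺ (n<1+n _ ∷ All.map m<n⇒m<1+n a<) ∷ AllPairs.map⁺ (AllPairs.map s≤s (a< ∷ asc))

  ∈-both-shifts : ∀ S {b} → b ∈ both-shifts S → ∃[ c ] ∃[ a ] a ∈ S × b ≡ shift c a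
  ∈-both-shifts (a ∷ S) (here refl) = false , a , here refl , refl
  ∈-both-shifts (a ∷ S) (there b∈) with ∈-map⁻ suc b∈
  ... | a′ , a′∈ , refl = true , a′ , a′∈ , refl

  -- An untouched switch lets the front grow by one. A touched switch only moves the front, but then
  -- it is itself an item of the new layer and supplies the missing one in `large`.
  frontier : ∀ e → Front (ℓ + e) e
  frontier zero = record
    { front = path s (ℓ + 0) ∷ []
    ; increasing = [] ∷ []
    ; reached = λ { (here refl) → record
        { turns = α s ∘ switch ; agrees = λ _ → refl
        ; avoids = λ ℓ<i i≤ → contradiction (≤-trans i≤ (≤-reflexive (+-identityʳ ℓ))) (<⇒≱ ℓ<i)
        ; ends-at = refl } }
    ; large = s≤s z≤n }
  frontier (suc e) = subst (λ m → Front m (suc e)) (sym (+-suc ℓ e)) (advance (switch m ∈? Z))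
    where
    m = ℓ + e
    F = frontier e
    open DecMembership _≟ᵛ_ using (_∈?_)
    length-both : ∀ S → suc e ≤ length S + load m Z → length (both-shifts S) ≡ suc (length S)
    length-both []      le = contradiction (≤-trans le (room s e)) (<-irrefl refl)
    length-both (a ∷ S) _  = cong (suc ∘ suc) (length-map suc S)
    advance : Dec (switch m ∈ Z) → Front (suc m) (suc e)
    advance (yes x∈) = record
      { front = survivors T ; increasing = ascending T
      ; reached = λ a∈ → reach a∈ (∈-map⁻ (shift c) (inherited T a∈))
      ; large = ≤-trans (s≤s (large F)) (≤-trans
          (≤-reflexive (cong (λ n → suc (n + load m Z)) (sym (length-map (shift c) (front F)))))
          (count-switch T x∈)) }
      where
      c = α s (switch m)
      T = surviving m (map (shift c) (front F))
            (AllPairs.map⁺ (AllPairs.map (shift-mono c) (increasing F))) Z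
      reach : ∀ {b} → b ∈ survivors T → (∃[ a ] a ∈ front F × b ≡ shift c a) → Reaches (suc m) b
      reach b∈ (a , a∈ , refl) =
        extend c (m≤m+n ℓ e) (λ _ → refl) (reached F a∈) (avoiding T b∈)
    advance (no x∉) = record
      { front = survivors T ; increasing = ascending T
      ; reached = λ a∈ → reach a∈ (∈-both-shifts (front F) (inherited T a∈))
      ; large = ≤-trans (s≤s (large F)) (≤-trans
          (≤-reflexive (cong (_+ load m Z) (sym (length-both (front F) (large F)))))
          (count T)) }
      where
      T = surviving m (both-shifts (front F)) (both-shifts-ascending (increasing F)) Z
      reach : ∀ {b} → b ∈ survivors T → (∃[ c ] ∃[ a ] a ∈ front F × b ≡ shift c a) →
              Reaches (suc m) b
      reach b∈ (c , a , a∈ , refl) =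
        extend c (m≤m+n ℓ e) (λ x∈ → contradiction x∈ x∉) (reached F a∈) (avoiding T b∈)

  route : ∀ e → ∃[ a ] Reaches (ℓ + e) a
  route e with front F | reached F | large F
    where F = frontier e
  ... | []    | _       | le = contradiction (≤-trans le (room s e)) (<-irrefl refl)
  ... | a ∷ _ | reaches | _  = a , reaches (here refl)

  -- A route to layer `ℓ + e` becomes the path. The touched items of the crossed layers are now
  -- known by their height and can be forgotten; they number at least e, which restores `room` at
  -- the new depth.
  commit : ∀ e → e ≤ load (ℓ + e) Z → Σ (Adversary L r) λ s′ → s ⊑ s′ × depth s′ ≡ ℓ + e
  commit e full = record
    { α = α′ ; depth = ℓ′ ; touched = deeper ℓ′ Z
    ; on = on′ ; off = off′
    ; room = λ e′ → +-cancelʳ-≤ e _ _ (begin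
        load (ℓ′ + e′) (deeper ℓ′ Z) + e         ≤⟨ +-monoʳ-≤ _ full ⟩
        load (ℓ′ + e′) (deeper ℓ′ Z) + load ℓ′ Z ≤⟨ load-deeper Z (m≤m+n ℓ′ e′) ⟩
        load (ℓ′ + e′) Z                         ≡⟨ cong (λ n → load n Z) (+-assoc ℓ e e′) ⟩
        load (ℓ + (e + e′)) Z                    ≤⟨ room s (e + e′) ⟩
        e + e′                                   ≡⟨ +-comm e e′ ⟩
        e′ + e                                   ∎)
    -- The e layers gained are paid for by at least e forgotten items.
    ; budget = ≤-<-trans (+-monoˡ-≤ r (begin
        ℓ + e + length (deeper ℓ′ Z)             ≡⟨ +-assoc ℓ e _ ⟩
        ℓ + (e + length (deeper ℓ′ Z))           ≤⟨ +-monoʳ-≤ ℓ (+-monoˡ-≤ _ full) ⟩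
        ℓ + (load ℓ′ Z + length (deeper ℓ′ Z))   ≡⟨ cong (ℓ +_) (+-comm (load ℓ′ Z) _) ⟩
        ℓ + (length (deeper ℓ′ Z) + load ℓ′ Z)   ≡⟨ cong (ℓ +_) (length-deeper ℓ′ Z) ⟩
        ℓ + length Z                             ∎)) (budget s)
    } , record { value = val _ ; known = kn } , refl
    where
    open ≤-Reasoning
    ℓ′ = ℓ + e
    R = proj₂ (route e)
    d = turns R
    new? : ∀ i a → Dec (i ≤ ℓ′ × a ≡ position d i)
    new? i a = i ≤? ℓ′ ×-dec a ≟ position d i
    α′ : Variable → Bool
    α′ (switch j)   = d j
    α′ (half k i a) = does (new? i a) ∨ α s (half k i a)
    same-path : ∀ {i} → i ≤ ℓ → path s i ≡ position d i
    same-path i≤ℓ = position-cong _ λ j j<i → sym (agrees R (inj₁ (<-≤-trans j<i i≤ℓ)))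
    on′ : ∀ {i} k → i ≤ ℓ′ → α′ (half k i (position d i)) ≡ true
    on′ {i} k i≤ rewrite dec-true (new? i (position d i)) (i≤ , refl) = refl
    old : ∀ {k i a} → ¬ (i ≤ ℓ′ × a ≡ position d i) → α′ (half k i a) ≡ α s (half k i a)
    old {k} {i} {a} ¬p rewrite dec-false (new? i a) ¬p = refl
    off′ : ∀ {i a} → α′ (half false i a) ≡ true → α′ (half true i a) ≡ true →
           i ≤ ℓ′ × a ≡ position d i
    off′ {i} {a} y z with new? i a
    ... | yes p = p
    -- A node active off the new path was active before, hence on the old path, which the new one
    -- continues.
    ... | no ¬p with off s (trans (sym (old ¬p)) y) (trans (sym (old ¬p)) z)
    ...   | i≤ℓ , refl = ≤-trans i≤ℓ (m≤m+n ℓ e) , same-path i≤ℓ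
    val : ∀ v → Known s v → α′ v ≡ α s v
    val (switch j) kn = agrees R kn
    val (half k i a) kn with new? i a
    ... | no ¬p = old ¬p
    ... | yes (i≤ , refl) with i ≤? ℓ
    ...   | yes i≤ℓ = trans (on′ k i≤)
      (sym (trans (cong (α s ∘ half k i) (sym (same-path i≤ℓ))) (on s k i≤ℓ)))
    ...   | no i≰ℓ with kn
    ...     | inj₁ i≤ℓ = contradiction i≤ℓ i≰ℓ
    ...     | inj₂ i∈ = contradiction i∈ (avoids R (≰⇒> i≰ℓ) i≤)
    kn : ∀ {v} → Known s v → height v ≤ ℓ′ ⊎ item v ∈ deeper ℓ′ Z
    kn (inj₁ h) = inj₁ (≤-trans h (m≤m+n ℓ e))
    kn {v} (inj₂ v∈) with ℓ′ <? height v
    ... | no h = inj₁ (≮⇒≥ h)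
    ... | yes h = inj₂ (∈-filter⁺ _ v∈ (subst (ℓ′ <_) (sym (height-item v)) h))

-- Answering a query

Decided : ∀ {L r} → Adversary L r → ℕ → Variable → Bool → Set
Decided {L} s r′ v b = Σ (Adversary L r′) λ s′ → s ⊑ s′ × Known s′ v × α s′ v ≡ b

module _ {L r} (s : Adversary L (suc r)) (v : Variable) (unknown : ¬ Known s v) where
  private
    ℓ = depth s
    Z = touched s

  branch : (∀ e → load (ℓ + e) (item v ∷ Z) ≤ e) → ∀ b → Decided s r v b
  branch fits b = record
    { α = α′ ; depth = ℓ ; touched = item v ∷ Z
    ; on = λ {i} k i≤ → trans (cong (α′ ∘ half k i) (path≡ i≤))
                              (trans (low (half k i (path s i)) i≤) (on s k i≤))
    ; off = off′
    ; room = fits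
    -- One touched item more and one guaranteed answer less leave the sum unchanged.
    ; budget = subst (_< L) (trans (+-suc _ r) (cong (_+ r) (sym (+-suc ℓ (length Z))))) (budget s)
    }
    , record { value = λ kn → away (known-≢ kn) ; known = λ { (inj₁ h)  → inj₁ h
                                                            ; (inj₂ w∈) → inj₂ (there w∈) } }
    , inj₂ (here refl) , at-v
    where
    α′ : Variable → Bool
    -- If `v` is half of a node, the other half becomes false, so the node is inactive for either
    -- answer b.
    α′ w = if does (w ≟ᵛ v) then b else if does (item w ≟ᵛ item v) then false else α s w
    at-v : α′ v ≡ b
    at-v rewrite dec-true (v ≟ᵛ v) refl = refl
    away : ∀ {w} → item w ≢ item v → α′ w ≡ α s w
    away {w} ≢v rewrite dec-false (w ≟ᵛ v) (≢v ∘ cong item) | dec-false (item w ≟ᵛ item v) ≢v = refl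
    known-≢ : ∀ {w} → Known s w → item w ≢ item v
    known-≢ {w} (inj₁ h)  eq = unknown (inj₁ (subst (_≤ ℓ)
      (trans (sym (height-item w)) (trans (cong height eq) (height-item v))) h))
    known-≢ {w} (inj₂ w∈) eq = unknown (inj₂ (subst (_∈ Z) eq w∈))
    low : ∀ w → height w ≤ ℓ → α′ w ≡ α s w
    low w h = away (known-≢ (inj₁ h))
    path≡ : ∀ {i} → i ≤ ℓ → position (α′ ∘ switch) i ≡ path s i
    path≡ i≤ = position-cong _ λ j j<i → low (switch j) (≤-trans j<i i≤)
    twin-false : ∀ {w} → item w ≡ item v → w ≢ v → α′ w ≡ false
    twin-false {w} eq w≢v rewrite dec-false (w ≟ᵛ v) w≢v | dec-true (item w ≟ᵛ item v) eq = refl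
    not-both : ∀ {w w′} → item w ≡ item v → item w′ ≡ item v → w ≢ w′ →
               α′ w ≡ true → α′ w′ ≢ true
    not-both {w} {w′} p q w≢w′ y z with toSum (w ≟ᵛ v)
    ... | inj₂ w≢v = contradiction (trans (sym y) (twin-false p w≢v)) λ ()
    ... | inj₁ refl = contradiction (trans (sym z) (twin-false q (w≢w′ ∘ sym))) λ ()
    off′ : ∀ {i a} → α′ (half false i a) ≡ true → α′ (half true i a) ≡ true →
           i ≤ ℓ × a ≡ position (α′ ∘ switch) i
    off′ {i} {a} y z with toSum (half false i a ≟ᵛ item v)
    ... | inj₁ eq = contradiction z (not-both eq eq (λ ()) y)
    ... | inj₂ ≢v with off s (trans (sym (away ≢v)) y) (trans (sym (away ≢v)) z)
    ...   | i≤ , eq = i≤ , trans eq (sym (path≡ i≤))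

-- If touching `v` would overload the first e layers below the path, then these already hold e
-- touched items and `v` lies within them. So `commit e` applies and makes `v` known by its height,
-- without spending a free answer.
answer : ∀ {L r} (s : Adversary L (suc r)) v →
         (∃[ b ] Decided s (suc r) v b) ⊎ (∀ b → Decided s r v b)
answer s v with height v ≤? depth s | item v ∈? touched s
  where open DecMembership _≟ᵛ_ using (_∈?_)
... | yes h | _      = inj₁ (_ , s , record { value = λ _ → refl ; known = id } , inj₁ h , refl)
... | no _  | yes v∈ = inj₁ (_ , s , record { value = λ _ → refl ; known = id } , inj₂ v∈ , refl)
-- A load never exceeds the length of the list, so an overload can occur only for e below
-- `length Z⁺`; this makes the search finite.
... | no h  | no v∉  = decide (anyUpTo? (λ e → e <? load (depth s + e) Z⁺) (length Z⁺))
  where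
  Z⁺ = item v ∷ touched s
  Overloaded : ℕ → Set
  Overloaded e = e < load (depth s + e) Z⁺
  within : ∀ e → Overloaded e → height v ≤ depth s + e
  within e over = ≮⇒≥ λ deep → <⇒≱ over (≤-trans (≤-reflexive (cong (_+ _)
    (weight-out (item v) (subst (depth s + e <_) (sym (height-item v)) deep)))) (room s e))
  full : ∀ e → Overloaded e → e ≤ load (depth s + e) (touched s)
  full e over = s≤s⁻¹ (≤-trans over (+-monoˡ-≤ _ (weight≤1 (depth s + e) (item v))))
  decide : Dec (∃[ e ] e < length Z⁺ × Overloaded e) → _
  decide (yes (e , _ , over)) with commit s e (full e over)
  ... | s′ , s⊑s′ , eq =
    inj₁ (_ , s′ , s⊑s′ , inj₁ (subst (height v ≤_) (sym eq) (within e over)) , refl)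
  decide (no fits) = inj₂ (branch s v (λ { (inj₁ p) → h p ; (inj₂ p) → v∉ p }) room′)
    where
    room′ : ∀ e → load (depth s + e) Z⁺ ≤ e
    room′ e with e <? length Z⁺
    ... | yes small = ≮⇒≥ λ over → fits (e , small , over)
    ... | no  big   = ≤-trans (load≤length _ Z⁺) (≮⇒≥ big)

-- The lower bound for TreeRes

-- Reading literals through `decode` gives the adversary an answer for every number, including those
-- that do not occur in the formula.
Falsifies : ∀ {L r} → Adversary L r → Literal → Set
Falsifies s (x , b) = α s (decode x) ≡ not b × Known s (decode x)

falsifies-⊑ : ∀ {L r r′} {s : Adversary L r} {s′ : Adversary L r′} → s ⊑ s′ →
              ∀ {C} → All (Falsifies s) C → All (Falsifies s′) C
falsifies-⊑ s⊑ []                = []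
falsifies-⊑ s⊑ ((eq , kn) ∷ fs) = (trans (value s⊑ kn) eq , known s⊑ kn) ∷ falsifies-⊑ s⊑ fs

-- A falsified edge leaves an active node, which lies on the path. Before the end of the path the
-- next node makes the axiom true. At the end, the switch and the successor would both be touched in
-- the first layer below, against `room`. A falsified end would need a path of depth L, which
-- `budget` excludes.
axiom-survives : ∀ {L r} (s : Adversary L r) {ax} → Occurs L ax → ¬ All (Falsifies s) (clause ax)
axiom-survives {L} s {ax} occ fs = refute occ (All.map (λ {p} → transport {p}) (All.map⁻ fs))
  where
  Fails : Variable × Bool → Set
  Fails (v , b) = α s v ≡ not b × Known s v
  transport : ∀ {p} → Falsifies s (encode p) → Fails p
  transport {v , b} = subst (λ w → α s w ≡ not b × Known s w) (decode-code v)
  shallow : depth s < L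
  shallow = ≤-<-trans (≤-trans (m≤m+n _ (length (touched s))) (m≤m+n _ _)) (budget s)
  true≢false : ∀ {b} → b ≡ true → b ≢ false
  true≢false refl ()
  overfull : ∀ {v w} → item v ≢ item w → Known s v → Known s w →
             height v ≡ suc (depth s) → height w ≢ suc (depth s)
  overfull _ (inj₁ h) _ eq _ = <-irrefl refl (subst (_≤ depth s) eq h)
  overfull _ (inj₂ _) (inj₁ h) _ eq = <-irrefl refl (subst (_≤ depth s) eq h)
  overfull {v} {w} v≢w (inj₂ v∈) (inj₂ w∈) eq eq′ =
    <-irrefl refl (≤-trans (load-∈₂ v∈ w∈ v≢w (at v eq) (at w eq′)) (room s 1))
    where
    at : ∀ u → height u ≡ suc (depth s) → height (item u) ≤ depth s + 1
    at u eq = ≤-reflexive (trans (height-item u) (trans eq (sym (+-comm (depth s) 1))))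
  refute : ∀ {ax} → Occurs L ax → ¬ All Fails (literals ax)
  refute (start {k}) ((eq , _) ∷ []) = true≢false (on s k z≤n) eq
  refute (edge {i} {a} {c} {k} _) ((x , kx) ∷ (y , _) ∷ (z , _) ∷ (h , kh) ∷ []) with off s y z
  ... | i≤ , refl with m≤n⇒m<n∨m≡n i≤
  ...   | inj₁ i<   = true≢false (trans (cong (λ c → α s (half k (suc i) (shift c (path s i))))
                                             (sym (trans x (not-involutive c)))) (on s k i<)) h
  ...   | inj₂ refl = overfull {switch i} {half k (suc i) _} (λ ()) kx kh refl refl
  refute (end {a}) ((y , _) ∷ (z , _) ∷ []) = <⇒≱ shallow (proj₁ (off s y z))

All-∼ : ∀ {p} {A : Set} {R : A → Set p} {xs ys : List A} → xs ∼[ set ] ys → All R ys → All R xs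
All-∼ xs∼ys rs = All.tabulate (λ x∈ → All.lookup rs (Equivalence.to xs∼ys x∈))

nodes-positive : ∀ {F C} (π : F ⊢ C) → 1 ≤ nodes π
nodes-positive (axiom _)                     = ≤-refl
nodes-positive (resolve _ _ _ _ _ _ _ _ _ _) = s≤s z≤n
nodes-positive (weaken _ _ _)                = s≤s z≤n

module _ {L F} (occurs : ∀ {C} → C ∈ clauses F → ∃[ ax ] C ≡ clause ax × Occurs L ax) where

  -- The adversary keeps the current clause falsified on the way from the root to the axioms and is
  -- queried about the resolved variable. A fixed answer selects one premise with the same r. A free
  -- answer is pursued into both premises, each with r lowered by one, and their sizes add up.
  2^r≤nodes : ∀ {r C} (π : F ⊢ C) (s : Adversary L r) → All (Falsifies s) C → 2 ^ r ≤ nodes π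
  2^r≤nodes (axiom C∈) s fs with occurs C∈
  ... | ax , refl , occ = contradiction fs (axiom-survives s occ)
  2^r≤nodes (weaken _ _ π) s (_ ∷ fs) = m≤n⇒m≤1+n (2^r≤nodes π s fs)
  2^r≤nodes {zero} π@(resolve _ _ _ _ _ _ _ _ _ _) s fs = nodes-positive π
  2^r≤nodes {suc r} (resolve {P} {Q} x C D P∼ _ Q∼ _ _ π ρ) s fs = query (answer s (decode x))
    where
    left : ∀ {r′} → Decided s r′ (decode x) false → 2 ^ r′ ≤ nodes π
    left (s′ , s⊑s′ , kn , eq) =
      2^r≤nodes π s′ (All-∼ P∼ ((eq , kn) ∷ falsifies-⊑ s⊑s′ (All.++⁻ˡ C fs)))
    right : ∀ {r′} → Decided s r′ (decode x) true → 2 ^ r′ ≤ nodes ρ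
    right (s′ , s⊑s′ , kn , eq) =
      2^r≤nodes ρ s′ (All-∼ Q∼ ((eq , kn) ∷ falsifies-⊑ s⊑s′ (All.++⁻ʳ C fs)))
    query : _ → 2 ^ suc r ≤ suc (nodes π + nodes ρ)
    query (inj₁ (false , s′)) = m≤n⇒m≤1+n (≤-trans (left s′) (m≤m+n _ _))
    query (inj₁ (true  , s′)) = m≤n⇒m≤1+n (≤-trans (right s′) (m≤n+m _ (nodes π)))
    query (inj₂ both)         = m≤n⇒m≤1+n (+-mono-≤ (left (both false))
      (≤-trans (≤-reflexive (+-identityʳ _)) (right (both true))))

-- Clauses as sets of encoded literals

antisym : ∀ {A : Set} {xs ys : List A} → All (_∈ ys) xs → All (_∈ xs) ys → xs ∼[ set ] ys
antisym xs⊆ys ys⊆xs = mk⇔ (All.lookup xs⊆ys) (All.lookup ys⊆xs)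

encode-injective : ∀ {p q} → encode p ≡ encode q → p ≡ q
encode-injective {v , b} {w , c} eq = cong₂ _,_ (code-injective (cong proj₁ eq)) (cong proj₂ eq)

∈-encode⁻ : ∀ {p ps} → encode p ∈ map encode ps → p ∈ ps
∈-encode⁻ {ps = ps} p∈ with ∈-map⁻ encode p∈
... | q , q∈ , eq = subst (_∈ ps) (sym (encode-injective eq)) q∈

isClause-∼ : ∀ {C D} → C ∼[ set ] D → IsClause C → IsClause D
isClause-∼ C∼D ok taut with find taut
... | l , l∈ , l̄∈ = ok (lose (Equivalence.from C∼D l∈) (Equivalence.from C∼D l̄∈))

-- Two complementary literals are never both false, so a falsifying assignment certifies that a
-- clause is not tautologous.
falsifiable⇒isClause : ∀ (α : Variable → Bool) ps → All (λ (v , b) → α v ≡ not b) ps →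
                       IsClause (map encode ps)
falsifiable⇒isClause α ps false-at taut with find taut
... | l , l∈ , l̄∈ with ∈-map⁻ encode l∈
... | (v , b) , p∈ , refl =
  not-¬ (All.lookup false-at p∈) (All.lookup false-at {v , not b} (∈-encode⁻ l̄∈))

-- What remains of the edge axioms for c once their target is known to be inactive.
premises : ℕ → ℕ → Bool → List (Variable × Bool)
premises i a c = (switch i , not c) ∷ (half false i a , false) ∷ (half true i a , false) ∷ []

isClause : ∀ ax → IsClause (clause ax)
isClause ax@(start k) = falsifiable⇒isClause (λ _ → false) (literals ax) (refl ∷ [])
isClause ax@(edge i a c k) = falsifiable⇒isClause
  (λ { (switch _) → c ; (half _ j _) → does (j ≤? i) }) (literals ax)
  (sym (not-involutive c) ∷ dec-true (i ≤? i) ≤-refl ∷ dec-true (i ≤? i) ≤-refl ∷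
   dec-false (suc i ≤? i) 1+n≰n ∷ [])
isClause ax@(end i a) = falsifiable⇒isClause (λ _ → true) (literals ax) (refl ∷ refl ∷ [])

-- The MaxRes refutations

refutation-↭ : ∀ {F G s} → F ↭ G → Refutation MaxResolution G s → Refutation MaxResolution F s
refutation-↭ F↭G (done □∈) with find (∈-resp-↭ (↭-sym F↭G) (Any.map ∼.reflexive □∈))
... | [] , C∈ , _ = done C∈
... | l ∷ _ , _ , □∼C with () ← Equivalence.from □∼C (here refl)
refutation-↭ F↭G (step (maxResolve x A B R x∉ x̄∉ G↭ H↭) π) =
  step (maxResolve x A B R x∉ x̄∉ (↭-trans F↭G G↭) H↭) π

-- Quantifying over the rest `J` allows clauses without further use to be discarded into it.
Refutable : ℕ → MultiSet → Set
Refutable s Δ = ∀ J → Refutation MaxResolution (Δ ++ J) s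

refutable-↭ : ∀ {s Γ Δ} → Γ ↭ Δ → Refutable s Δ → Refutable s Γ
refutable-↭ Γ↭Δ r J = refutation-↭ (++⁺ʳ J Γ↭Δ) (r J)

refutable-∷ : ∀ {s Δ} C → Refutable s Δ → Refutable s (C ∷ Δ)
refutable-∷ {Δ = Δ} C r J = refutation-↭
  (solve 3 (λ c d j → (c ⊕ (d ⊕ j)) ⊜ (d ⊕ (c ⊕ j))) ↭-refl [ C ] Δ J) (r (C ∷ J))

filter-isClause : ∀ {C} Cs → IsClause C → filter isClause? (C ∷ Cs) ≡ C ∷ filter isClause? Cs
filter-isClause _ = filter-accept isClause?

-- Keeps only the resolvent; the remaining consequents `K` go into `J`.
resolve₁ : ∀ {s Δ P Q} C x A B →
           P ∼[ set ] (pos x ∷ A) → pos x ∉ A → Q ∼[ set ] (neg x ∷ B) → neg x ∉ B →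
           C ∼[ set ] (A ++ B) → IsClause C →
           Refutable s (C ∷ Δ) → Refutable (suc s) (P ∷ Q ∷ Δ)
resolve₁ {Δ = Δ} C x A B P∼ x∉ Q∼ x̄∉ C∼ okC r J = step
  (maxResolve x A B (Δ ++ J) x∉ x̄∉ (prep P∼ (prep Q∼ ↭-refl))
    (↭-trans (prep C∼ (shifts Δ K)) (↭-reflexive (cong (_++ (Δ ++ J)) (sym kept)))))
  (r (K ++ J))
  where
  K = filter isClause? (chain (pos x ∷ A) B ++ chain (neg x ∷ B) A)
  kept : filter isClause? (consequents x A B) ≡ (A ++ B) ∷ K
  kept = filter-isClause _ (isClause-∼ C∼ okC)

-- Besides the resolvent C, keeps the first clause D of the chain on the literals of P.
resolve₂ : ∀ {s Δ P Q} C D x a A B →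
           P ∼[ set ] (pos x ∷ a ∷ A) → pos x ∉ (a ∷ A) →
           Q ∼[ set ] (neg x ∷ B) → neg x ∉ B →
           C ∼[ set ] (a ∷ A ++ B) → IsClause C →
           D ∼[ set ] (complement a ∷ neg x ∷ B) → IsClause D →
           Refutable s (C ∷ D ∷ Δ) → Refutable (suc s) (P ∷ Q ∷ Δ)
resolve₂ {Δ = Δ} C D x a A B P∼ x∉ Q∼ x̄∉ C∼ okC D∼ okD r J = step
  (maxResolve x (a ∷ A) B (Δ ++ J) x∉ x̄∉ (prep P∼ (prep Q∼ ↭-refl))
    (↭-trans (prep C∼ (prep D∼ ↭-refl))
    (↭-trans (solve 6 (λ c d k l δ j →
                 (c ⊕ (d ⊕ (δ ⊕ (k ⊕ (l ⊕ j))))) ⊜ ((c ⊕ (k ⊕ (d ⊕ l))) ⊕ (δ ⊕ j)))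
               ↭-refl [ _ ] [ _ ] K L Δ J)
             (↭-reflexive (cong (_++ (Δ ++ J)) (sym kept))))))
  (r (K ++ L ++ J))
  where
  K = filter isClause? (chain (pos x ∷ a ∷ A) B)
  L = filter isClause? (chain (a ∷ neg x ∷ B) A)
  kept : filter isClause? (consequents x (a ∷ A) B) ≡
         (a ∷ A ++ B) ∷ K ++ (complement a ∷ neg x ∷ B) ∷ L
  kept = trans (filter-isClause _ (isClause-∼ C∼ okC)) (cong ((a ∷ A ++ B) ∷_)
    (trans (filter-++ isClause? (chain (pos x ∷ a ∷ A) B) _)
           (cong (K ++_) (filter-isClause _ (isClause-∼ D∼ okD)))))

-- The clause that (i , a) is inactive, weakened by ps.
inactive : ℕ → ℕ → List (Variable × Bool) → Disjunction
inactive i a ps = map encode ((half false i a , false) ∷ (half true i a , false) ∷ ps)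

-- A target clause is either intact or weakened by an earlier use. The weakening literal already
-- belongs to `premises i a c`, so the resolvents are the same.
data Slack (i : ℕ) (c : Bool) : List (Variable × Bool) → Set where
  none : Slack i c []
  one  : Slack i c [ (switch i , not c) ]

module _ (i a : ℕ) (c : Bool) where
  private
    b = shift c a
    N = map encode (premises i a c)
    upper = half false (suc i) b
    lower = half true (suc i) b
    M : Disjunction
    M = neg (code lower) ∷ N

  N-isClause : IsClause N
  N-isClause = falsifiable⇒isClause (λ { (switch _) → c ; (half _ _ _) → true }) (premises i a c)
    (sym (not-involutive c) ∷ refl ∷ refl ∷ [])

  M-isClause : IsClause M
  M-isClause = falsifiable⇒isClause
    (λ { (switch _) → c ; (half _ _ _) → true }) ((lower , false) ∷ premises i a c)
    (refl ∷ sym (not-involutive c) ∷ refl ∷ refl ∷ [])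

  edge∼ : ∀ k → clause (edge i a c k) ∼[ set ] (pos (code (half k (suc i) b)) ∷ N)
  edge∼ k = antisym
    (there (here refl) ∷ there (there (here refl)) ∷ there (there (there (here refl))) ∷
     here refl ∷ [])
    (there (there (there (here refl))) ∷ here refl ∷ there (here refl) ∷
     there (there (here refl)) ∷ [])

  target∉ : ∀ {k} → pos (code (half k (suc i) b)) ∉ N
  target∉ {k} p with ∈-encode⁻ {half k (suc i) b , true} {premises i a c} p
  ... | there (there (there ()))

  lower∉ : neg (code lower) ∉ N
  lower∉ p with ∈-encode⁻ {lower , false} {premises i a c} p
  ... | there (there (there ()))

  upper∉ : ∀ {ps} → Slack i c ps → neg (code upper) ∉ map encode ((lower , false) ∷ ps)
  upper∉ {ps} slack p with slack | ∈-encode⁻ {upper , false} {(lower , false) ∷ ps} p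
  ... | none | there ()
  ... | one | there (there ())

  upper-resolvent : ∀ {ps} → Slack i c ps → M ∼[ set ] (N ++ map encode ((lower , false) ∷ ps))
  upper-resolvent none = antisym
    (there (there (there (here refl))) ∷ here refl ∷ there (here refl) ∷
     there (there (here refl)) ∷ [])
    (there (here refl) ∷ there (there (here refl)) ∷ there (there (there (here refl))) ∷
     here refl ∷ [])
  upper-resolvent one = antisym
    (there (there (there (here refl))) ∷ here refl ∷ there (here refl) ∷
     there (there (here refl)) ∷ [])
    (there (here refl) ∷ there (there (here refl)) ∷ there (there (there (here refl))) ∷
     here refl ∷ there (here refl) ∷ [])

  resolve-lower : ∀ {s Δ} → Refutable s (N ∷ Δ) →
    Refutable (suc s) (clause (edge i a c true) ∷ M ∷ Δ)
  resolve-lower = resolve₁ N (code lower) N N (edge∼ true) target∉ ∼.refl lower∉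
    (∼.sym (++-idempotent N)) N-isClause

  resolve-target : ∀ {s Δ ps} → Slack i c ps → Refutable s (N ∷ Δ) →
    Refutable (2 + s) (clause (edge i a c false) ∷ inactive (suc i) b ps ∷
                       clause (edge i a c true) ∷ Δ)
  resolve-target {Δ = Δ} {ps} slack r =
    resolve₁ M (code upper) N (map encode ((lower , false) ∷ ps))
      (edge∼ false) target∉ ∼.refl (upper∉ slack) (upper-resolvent slack) M-isClause
      (refutable-↭ (↭-swap M _ ↭-refl) (resolve-lower r))

released : ℕ → Variable × Bool
released i = switch i , false

-- Side literals are enumerated with the switch first. The first clause of the chain is then the
-- target clause weakened by `released i`, as the edge with switch value true from the left
-- neighbour can still use it.
resolve-target-keeping : ∀ i a {s Δ} →
  Refutable s (map encode (premises i a false) ∷ inactive (suc i) a [ released i ] ∷ Δ) →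
  Refutable (2 + s) (clause (edge i a false false) ∷ inactive (suc i) a [] ∷
                     clause (edge i a false true) ∷ Δ)
resolve-target-keeping i a {Δ = Δ} r =
  resolve₂ M D (code (half false (suc i) a)) (encode (switch i , true))
    (inactive i a []) (map encode [ half true (suc i) a , false ])
    (edge∼ i a false false) (target∉ i a false) ∼.refl (upper∉ i a false none)
    (upper-resolvent i a false none) (M-isClause i a false)
    (antisym (there (here refl) ∷ there (there (here refl)) ∷ here refl ∷ [])
             (there (there (here refl)) ∷ here refl ∷ there (here refl) ∷ []))
    (falsifiable⇒isClause (λ _ → true) _ (refl ∷ refl ∷ refl ∷ []))
    (refutable-↭ (solve 4 (λ m d e δ → (m ⊕ (d ⊕ (e ⊕ δ))) ⊜ (e ⊕ (m ⊕ (d ⊕ δ))))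
                   ↭-refl [ _ ] [ _ ] [ _ ] Δ)
      (resolve-lower i a false {Δ = D ∷ Δ} r))
  where
  M = map encode ((half true (suc i) a , false) ∷ premises i a false)
  D = inactive (suc i) a [ released i ]

merge : ∀ i a {s Δ} → Refutable s (inactive i a [] ∷ Δ) →
  Refutable (suc s) (map encode (premises i a false) ∷ map encode (premises i a true) ∷ Δ)
merge i a = resolve₁ (inactive i a []) (code (switch i)) (inactive i a []) (inactive i a [])
  ∼.refl (λ p → absent (∈-encode⁻ {switch i , true} p))
  ∼.refl (λ p → absent (∈-encode⁻ {switch i , false} p))
  (∼.sym (++-idempotent (inactive i a []))) (isClause (end i a))
  where
  absent : ∀ {b} → (switch i , b) ∉ literals (end i a)
  absent (there (there ()))

-- Five resolutions per node: two for each successor, one for each half, and a last one on the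
-- switch.
cell : ∀ i a {s Δ ps} → Slack i true ps →
  Refutable s (inactive (suc i) a [ released i ] ∷ inactive i a [] ∷ Δ) →
  Refutable (5 + s) (inactive (suc i) (suc a) ps ∷ inactive (suc i) a [] ∷
    clause (edge i a true false) ∷ clause (edge i a true true) ∷
    clause (edge i a false false) ∷ clause (edge i a false true) ∷ Δ)
cell i a {Δ = Δ} {ps} slack r =
  refutable-↭ (solve 7 (λ d e t₀ t₁ f₀ f₁ δ →
      (d ⊕ (e ⊕ (t₀ ⊕ (t₁ ⊕ (f₀ ⊕ (f₁ ⊕ δ)))))) ⊜ (t₀ ⊕ (d ⊕ (t₁ ⊕ (f₀ ⊕ (e ⊕ (f₁ ⊕ δ)))))))
      ↭-refl [ _ ] [ _ ] [ _ ] [ _ ] [ _ ] [ _ ] Δ)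
  (resolve-target i a true {Δ = clause (edge i a false false) ∷ inactive (suc i) a [] ∷
                                clause (edge i a false true) ∷ Δ} slack
  (refutable-↭ (solve 5 (λ n f₀ e f₁ δ → (n ⊕ (f₀ ⊕ (e ⊕ (f₁ ⊕ δ)))) ⊜ (f₀ ⊕ (e ⊕ (f₁ ⊕ (n ⊕ δ)))))
      ↭-refl [ _ ] [ _ ] [ _ ] [ _ ] Δ)
  (resolve-target-keeping i a {Δ = map encode (premises i a true) ∷ Δ}
  (refutable-↭ (solve 4 (λ n d m δ → (n ⊕ (d ⊕ (m ⊕ δ))) ⊜ (n ⊕ (m ⊕ (d ⊕ δ))))
      ↭-refl [ _ ] [ _ ] [ _ ] Δ)
  (merge i a {Δ = inactive (suc i) a [ released i ] ∷ Δ}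
  (refutable-↭ (solve 3 (λ e d δ → (e ⊕ (d ⊕ δ)) ⊜ (d ⊕ (e ⊕ δ))) ↭-refl [ _ ] [ _ ] Δ) r))))))

-- Cells are processed from right to left: the weakened clause left by one cell is the clause for
-- the right successor in the next.
row : ∀ i n {s Δ ps} → Slack i true ps →
  Refutable s (map clause (ends i n) ++ Δ) →
  Refutable (n * 5 + s) (inactive (suc i) n ps ∷
    map clause (ends (suc i) n) ++ map clause (edges i n) ++ Δ)
row i zero slack r = refutable-∷ _ r
row i (suc n) {Δ = Δ} slack r =
  refutable-↭ (solve 9 (λ d e t₀ t₁ f₀ f₁ es ts δ →
      (d ⊕ ((e ⊕ es) ⊕ ((t₀ ⊕ (t₁ ⊕ (f₀ ⊕ (f₁ ⊕ ts)))) ⊕ δ))) ⊜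
      (d ⊕ (e ⊕ (t₀ ⊕ (t₁ ⊕ (f₀ ⊕ (f₁ ⊕ (es ⊕ (ts ⊕ δ)))))))))
      ↭-refl [ _ ] [ _ ] [ _ ] [ _ ] [ _ ] [ _ ] Es Ts Δ)
  (cell i n slack
  (refutable-↭ (solve 5 (λ d e es ts δ → (d ⊕ (e ⊕ (es ⊕ (ts ⊕ δ)))) ⊜ (d ⊕ (es ⊕ (ts ⊕ (e ⊕ δ)))))
      ↭-refl [ _ ] [ _ ] Es Ts Δ)
  (row i n {Δ = clause (end i n) ∷ Δ} one
  (refutable-↭ (shifts (map clause (ends i n)) [ clause (end i n) ] {Δ}) r))))
  where
  Es = map clause (ends (suc i) n)
  Ts = map clause (edges i n)

steps : ℕ → ℕ
steps zero    = 2
steps (suc i) = suc i * 5 + steps i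

refute-start : Refutable 2 (map clause (axioms 0))
refute-start = refutable-↭ (↭-swap _ _ ↭-refl)
  (resolve₁ C (code (half false 0 0)) [] C ∼.refl (λ ()) ∼.refl C∌ ∼.refl
    (falsifiable⇒isClause (λ _ → true) _ (refl ∷ []))
  (refutable-↭ (↭-swap _ _ ↭-refl)
  (resolve₁ [] (code (half true 0 0)) [] [] ∼.refl (λ ()) ∼.refl (λ ()) ∼.refl (λ ())
  (λ J → done (here refl)))))
  where
  C = map encode [ half true 0 0 , false ]
  C∌ : neg (code (half false 0 0)) ∉ C
  C∌ p with ∈-encode⁻ {half false 0 0 , false} p
  ... | there ()

-- After `row i` has moved inactivity from layer `suc i` to layer i, the clauses kept are those of
-- `axioms i`.
refute : ∀ L → Refutable (steps L) (map clause (axioms L))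
refute zero = refute-start
refute (suc i) = subst (Refutable (steps (suc i))) (sym split)
  (row i (suc i) none
    (subst (Refutable (steps i)) (map-++ clause (ends i (suc i)) (above i)) (refute i)))
  where
  split : map clause (axioms (suc i)) ≡ clause (end (suc i) (suc i)) ∷
    map clause (ends (suc i) (suc i)) ++ map clause (edges i (suc i)) ++ map clause (above i)
  split = cong (clause (end (suc i) (suc i)) ∷_)
    (trans (map-++ clause (ends (suc i) (suc i)) _)
           (cong (map clause (ends (suc i) (suc i)) ++_)
                 (map-++ clause (edges i (suc i)) (above i))))

-- The clauses are pairwise distinct

data Below (n : ℕ) : Axiom → Set where
  start : ∀ {k} → Below n (start k)
  edge  : ∀ {i a c k} → i < n → Below n (edge i a c k)

edges-below : ∀ i n → All (Below (suc i)) (edges i n)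
edges-below i zero    = []
edges-below i (suc n) = edge ≤-refl ∷ edge ≤-refl ∷ edge ≤-refl ∷ edge ≤-refl ∷ edges-below i n

above-below : ∀ i → All (Below i) (above i)
above-below zero    = start ∷ start ∷ []
above-below (suc i) = All.++⁺ (edges-below i (suc i)) (All.map below-suc (above-below i))
  where
  below-suc : ∀ {n ax} → Below n ax → Below (suc n) ax
  below-suc start      = start
  below-suc (edge i<n) = edge (m<n⇒m<1+n i<n)

ends-occur : ∀ {L} n → All (Occurs L) (ends L n)
ends-occur zero    = []
ends-occur (suc n) = end ∷ ends-occur n

axioms-occur : ∀ L → All (Occurs L) (axioms L)
axioms-occur L = All.++⁺ (ends-occur (suc L))
  (All.map (λ { start → start ; (edge i<L) → edge i<L }) (above-below L))

side : Variable → Bool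
side (switch _)   = false
side (half k _ _) = k

switch-of-edge : ∀ {j b i a c k} → (switch j , b) ∈ literals (edge i a c k) → j ≡ i × b ≡ not c
switch-of-edge (here refl) = refl , refl
switch-of-edge (there (there (there (here ()))))

source-of-edge : ∀ {b i a c k} → (half false i b , false) ∈ literals (edge i a c k) → b ≡ a
source-of-edge (there (here refl)) = refl
source-of-edge (there (there (there (here ()))))

target-of-edge : ∀ {k′ j b i a c k} → (half k′ j b , true) ∈ literals (edge i a c k) → k′ ≡ k
target-of-edge (there (there (there (here eq)))) = cong (side ∘ proj₁) eq

-- Stated before encoding, where pattern matching can compare variables; codes are opaque.
literals-injective : ∀ {p q} → (∀ {l} → l ∈ literals p → l ∈ literals q) →
                     (∀ {l} → l ∈ literals q → l ∈ literals p) → p ≡ q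
literals-injective {start k} {start k′} p⊆q _ with p⊆q (here refl)
... | here refl = refl
literals-injective {start k} {edge i a c k′} _ q⊆p with q⊆p (here refl)
... | here ()
... | there ()
literals-injective {start k} {end i a} _ q⊆p with q⊆p (here refl)
... | here ()
... | there ()
literals-injective {edge i a c k} {start k′} p⊆q _ with p⊆q (here refl)
... | here ()
... | there ()
literals-injective {edge i a c k} {edge i′ a′ c′ k′} p⊆q _
  with switch-of-edge {c = c′} (p⊆q (here refl))
... | refl , eq with not-injective eq | source-of-edge {c = c′} (p⊆q (there (here refl)))
                   | target-of-edge {c = c′} (p⊆q (there (there (there (here refl)))))
...   | refl | refl | refl = refl
literals-injective {edge i a c k} {end i′ a′} p⊆q _ with p⊆q (here refl)
... | there (there ())
literals-injective {end i a} {start k} p⊆q _ with p⊆q (here refl)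
... | here ()
... | there ()
literals-injective {end i a} {edge i′ a′ c k} _ q⊆p with q⊆p (here refl)
... | there (there ())
literals-injective {end i a} {end i′ a′} p⊆q _ with p⊆q (here refl)
... | here refl = refl
... | there (here ())

clause-injective : ∀ {p q} → clause p ∼[ set ] clause q → p ≡ q
clause-injective p∼q = literals-injective
  (∈-encode⁻ ∘ Equivalence.to p∼q ∘ ∈-map⁺ encode)
  (∈-encode⁻ ∘ Equivalence.from p∼q ∘ ∈-map⁺ encode)

data EdgeBefore (i n : ℕ) : Axiom → Set where
  edge : ∀ {a c k} → a < n → EdgeBefore i n (edge i a c k)

edges-before : ∀ i n → All (EdgeBefore i n) (edges i n)
edges-before i zero    = []
edges-before i (suc n) = edge ≤-refl ∷ edge ≤-refl ∷ edge ≤-refl ∷ edge ≤-refl ∷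
  All.map (λ { (edge a<n) → edge (m<n⇒m<1+n a<n) }) (edges-before i n)

data EndBefore (i n : ℕ) : Axiom → Set where
  end : ∀ {a} → a < n → EndBefore i n (end i a)

ends-before : ∀ i n → All (EndBefore i n) (ends i n)
ends-before i zero    = []
ends-before i (suc n) = end ≤-refl ∷
  All.map (λ { (end a<n) → end (m<n⇒m<1+n a<n) }) (ends-before i n)

Distinct : List Axiom → Set
Distinct = AllPairs _≢_

edges-distinct : ∀ i n → Distinct (edges i n)
edges-distinct i zero    = []
edges-distinct i (suc n) =
  ((λ ()) ∷ (λ ()) ∷ (λ ()) ∷ fresh) ∷ ((λ ()) ∷ (λ ()) ∷ fresh) ∷ ((λ ()) ∷ fresh) ∷ fresh ∷
  edges-distinct i n
  where
  fresh : ∀ {c k} → All (edge i n c k ≢_) (edges i n)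
  fresh = All.map (λ { (edge n<n) refl → n≮n n n<n }) (edges-before i n)

ends-distinct : ∀ i n → Distinct (ends i n)
ends-distinct i zero    = []
ends-distinct i (suc n) =
  All.map (λ { (end n<n) refl → n≮n n n<n }) (ends-before i n) ∷ ends-distinct i n

above-distinct : ∀ i → Distinct (above i)
above-distinct zero    = ((λ ()) ∷ []) ∷ [] ∷ []
above-distinct (suc i) = AllPairs.++⁺ (edges-distinct i (suc i)) (above-distinct i)
  (All.map (λ p → All.map (disjoint p) (above-below i)) (edges-before i (suc i)))
  where
  disjoint : ∀ {p q} → EdgeBefore i (suc i) p → Below i q → p ≢ q
  disjoint (edge _) (edge i<i) refl = n≮n i i<i

axioms-distinct : ∀ L → Distinct (axioms L)
axioms-distinct L = AllPairs.++⁺ (ends-distinct L (suc L)) (above-distinct L)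
  (All.map (λ p → All.map (disjoint p) (above-below L)) (ends-before L (suc L)))
  where
  disjoint : ∀ {p q} → EndBefore L (suc L) p → Below L q → p ≢ q
  disjoint (end _) () refl

formula : ℕ → CNF
formula L = record
  { clauses    = map clause (axioms L)
  ; areClauses = All.map⁺ (All.universal isClause (axioms L))
  ; distinct   = AllPairs.map⁺ (AllPairs.map (λ p≢q → p≢q ∘ clause-injective) (axioms-distinct L))
  }

formula-occurs : ∀ L {C} → C ∈ clauses (formula L) → ∃[ ax ] C ≡ clause ax × Occurs L ax
formula-occurs L C∈ with ∈-map⁻ clause C∈
... | ax , ax∈ , eq = ax , eq , All.lookup (axioms-occur L) ax∈

-- Unsatisfiability

∈-edges : ∀ i {a n} c k → a < n → edge i a c k ∈ edges i n
∈-edges i {a} {suc n} c k a<1+n with m<1+n⇒m<n∨m≡n a<1+n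
... | inj₁ a<n = there (there (there (there (∈-edges i c k a<n))))
∈-edges i true  false _ | inj₂ refl = here refl
∈-edges i true  true  _ | inj₂ refl = there (here refl)
∈-edges i false false _ | inj₂ refl = there (there (here refl))
∈-edges i false true  _ | inj₂ refl = there (there (there (here refl)))

∈-ends : ∀ i {a n} → a < n → end i a ∈ ends i n
∈-ends i {a} {suc n} a<1+n with m<1+n⇒m<n∨m≡n a<1+n
... | inj₁ a<n  = there (∈-ends i a<n)
... | inj₂ refl = here refl

start∈above : ∀ i k → start k ∈ above i
start∈above zero    false = here refl
start∈above zero    true  = there (here refl)
start∈above (suc i) k     = ∈-++⁺ʳ (edges i (suc i)) (start∈above i k)

edge∈above : ∀ {i a n} c k → i < n → a ≤ i → edge i a c k ∈ above n
edge∈above {i} {a} {suc n} c k i<1+n a≤i with m<1+n⇒m<n∨m≡n i<1+n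
... | inj₁ i<n  = ∈-++⁺ʳ (edges n (suc n)) (edge∈above c k i<n a≤i)
... | inj₂ refl = ∈-++⁺ˡ (∈-edges n c k (s≤s a≤i))

formula-unsatisfiable : ∀ L → Unsatisfiable (formula L)
formula-unsatisfiable L α sat = inactive-end (active L ≤-refl)
  where
  Active : ℕ → ℕ → Set
  Active i a = ∀ k → α (code (half k i a)) ≡ true
  holds : ∀ {ax} → ax ∈ axioms L → Any (α ⊨ˡ_) (clause ax)
  holds ax∈ = All.lookup (All.map⁻ sat) ax∈
  active : ∀ i → i ≤ L → ∃[ a ] a ≤ i × Active i a
  active zero    _   = 0 , z≤n , λ k →
    case-start (holds (∈-++⁺ʳ (ends L (suc L)) (start∈above L k)))
    where
    case-start : ∀ {k} → Any (α ⊨ˡ_) (clause (start k)) → α (code (half k 0 0)) ≡ true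
    case-start (here eq) = eq
  active (suc i) i<L with active i (<⇒≤ i<L)
  ... | a , a≤i , act = shift c a , shift≤ c , λ k →
    case-edge (holds (∈-++⁺ʳ (ends L (suc L)) (edge∈above c k i<L a≤i)))
    where
    -- The value of the switch under α selects the edge whose switch literal fails.
    c = α (code (switch i))
    shift≤ : ∀ c → shift c a ≤ suc i
    shift≤ false = m≤n⇒m≤1+n a≤i
    shift≤ true  = s≤s a≤i
    case-edge : ∀ {k} → Any (α ⊨ˡ_) (clause (edge i a c k)) →
                α (code (half k (suc i) (shift c a))) ≡ true
    case-edge (here eq)                         = contradiction eq (not-¬ refl)
    case-edge (there (here eq))                 = contradiction (trans (sym (act false)) eq) λ ()
    case-edge (there (there (here eq)))         = contradiction (trans (sym (act true)) eq) λ ()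
    case-edge (there (there (there (here eq)))) = eq
  inactive-end : ¬ (∃[ a ] a ≤ L × Active L a)
  inactive-end (a , a≤L , act) with holds (∈-++⁺ˡ (∈-ends L (s≤s a≤L)))
  ... | here eq         = contradiction (trans (sym (act false)) eq) λ ()
  ... | there (here eq) = contradiction (trans (sym (act true)) eq) λ ()

-- Size of the formulas and of their refutations

length-edges : ∀ i n → length (edges i n) ≡ n * 4
length-edges i zero    = refl
length-edges i (suc n) = cong (4 +_) (length-edges i n)

length-ends : ∀ i n → length (ends i n) ≡ n
length-ends i zero    = refl
length-ends i (suc n) = cong suc (length-ends i n)

length-above : ∀ i → length (above i) ≤ 4 * (suc i * suc i)
length-above zero    = s≤s (s≤s z≤n)
length-above (suc i) = begin
  length (edges i (suc i) ++ above i)           ≡⟨ length-++ (edges i (suc i)) ⟩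
  length (edges i (suc i)) + length (above i)
    ≡⟨ cong (_+ length (above i)) (length-edges i (suc i)) ⟩
  suc i * 4 + length (above i)                  ≤⟨ +-monoʳ-≤ (suc i * 4) (length-above i) ⟩
  -- The summand `8 + 4 * i` is the exact gap to the next bound.
  suc i * 4 + 4 * (suc i * suc i)               ≤⟨ m≤m+n _ (8 + 4 * i) ⟩
  suc i * 4 + 4 * (suc i * suc i) + (8 + 4 * i) ≡⟨ identity i ⟩
  4 * (suc (suc i) * suc (suc i))               ∎
  where
  open ≤-Reasoning
  identity : ∀ i → suc i * 4 + 4 * (suc i * suc i) + (8 + 4 * i) ≡ 4 * (suc (suc i) * suc (suc i))
  identity = solve-∀

size-clause : ∀ ax → suc (width (clause ax)) ≤ 5
size-clause ax = s≤s (≤-trans (length-deduplicate _≟ˡ_ (clause ax))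
  (≤-trans (≤-reflexive (length-map encode (literals ax))) (few ax)))
  where
  few : ∀ ax → length (literals ax) ≤ 4
  few (start _)      = s≤s z≤n
  few (edge _ _ _ _) = ≤-refl
  few (end _ _)      = s≤s (s≤s z≤n)

steps≤ : ∀ i → steps i ≤ 5 * (suc i * suc i)
steps≤ zero    = s≤s (s≤s z≤n)
steps≤ (suc i) = begin
  suc i * 5 + steps i                     ≤⟨ +-monoʳ-≤ (suc i * 5) (steps≤ i) ⟩
  suc i * 5 + 5 * (suc i * suc i)         ≤⟨ m≤m+n _ (10 + 5 * i) ⟩
  suc i * 5 + 5 * (suc i * suc i) + (10 + 5 * i) ≡⟨ identity i ⟩
  5 * (suc (suc i) * suc (suc i))         ∎
  where
  open ≤-Reasoning
  identity : ∀ i → suc i * 5 + 5 * (suc i * suc i) + (10 + 5 * i) ≡ 5 * (suc (suc i) * suc (suc i))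
  identity = solve-∀

-- The factor 30 is 5 for the steps plus 5 times 5 for at most `5 * n²` clauses of size at most 5.
size≤ : ∀ L → steps L + ∣ formula L ∣ ≤ 30 * (suc L * suc L)
size≤ L = begin
  steps L + ∣ formula L ∣                   ≤⟨ +-mono-≤ (steps≤ L) (sum-clauses (axioms L)) ⟩
  5 * n² + length (axioms L) * 5            ≤⟨ +-monoʳ-≤ (5 * n²) (*-monoˡ-≤ 5 number) ⟩
  5 * n² + (n² + 4 * n²) * 5                ≡⟨ identity n² ⟩
  30 * n²                                   ∎
  where
  open ≤-Reasoning
  n² = suc L * suc L
  identity : ∀ m → 5 * m + (m + 4 * m) * 5 ≡ 30 * m
  identity = solve-∀
  number : length (axioms L) ≤ n² + 4 * n²
  number = begin
    length (axioms L)                           ≡⟨ length-++ (ends L (suc L)) ⟩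
    length (ends L (suc L)) + length (above L)
      ≡⟨ cong (_+ length (above L)) (length-ends L (suc L)) ⟩
    suc L + length (above L)                    ≤⟨ +-mono-≤ (m≤m*n (suc L) _) (length-above L) ⟩
    n² + 4 * n²                                 ∎
  sum-clauses : ∀ axs → sum (map (λ C → suc (width C)) (map clause axs)) ≤ length axs * 5
  sum-clauses []         = z≤n
  sum-clauses (ax ∷ axs) = +-mono-≤ (size-clause ax) (sum-clauses axs)

-- Exponentials outgrow polynomials

-- The base is `suc n` so that its powers are positive and grow with the exponent even for n = 0.
eval≤ : ∀ p n → eval p n ≤ sum p * suc n ^ length p
eval≤ []      n = z≤n
eval≤ (a ∷ p) n = begin
  a + n * eval p n
    ≤⟨ +-mono-≤ (m≤m*n a (suc n ^ suc d) {{m^n≢0 (suc n) (suc d)}})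
                (*-mono-≤ (n≤1+n n) (eval≤ p n)) ⟩
  a * suc n ^ suc d + suc n * (sum p * suc n ^ d)
    ≡⟨ identity a (sum p) (suc n) (suc n ^ d) ⟩
  (a + sum p) * suc n ^ suc d
    ∎
  where
  open ≤-Reasoning
  d = length p
  identity : ∀ a s m q → a * (m * q) + m * (s * q) ≡ (a + s) * (m * q)
  identity = solve-∀

n<2^n : ∀ n → n < 2 ^ n
n<2^n zero    = s≤s z≤n
n<2^n (suc n) = begin-strict
  suc n             <⟨ s≤s (n<2^n n) ⟩
  suc (2 ^ n)       ≤⟨ +-monoˡ-≤ (2 ^ n) (m^n>0 2 n) ⟩
  2 ^ n + 2 ^ n     ≡⟨ cong (2 ^ n +_) (+-identityʳ (2 ^ n)) ⟨
  2 ^ suc n         ∎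
  where open ≤-Reasoning

-- At `j = q + q` the right side is the square of `2 ^ q` and exceeds `q * suc q`, whereas the left
-- side is linear in q with slope `2 * b`, less than q by the choice of q.
linear<2^ : ∀ a b → ∃[ j ] a + b * j < 2 ^ j
linear<2^ a b = q + q , (begin-strict
  a + b * (q + q)      ≤⟨ m≤m+n _ _ ⟩
  a + b * (q + q) + (a * q + q + 1 + 2 * b) ≡⟨ identity a b q ⟩
  q * suc q            <⟨ *-monoˡ-< (suc q) (n<2^n q) ⟩
  2 ^ q * suc q        ≤⟨ *-monoʳ-≤ (2 ^ q) (n<2^n q) ⟩
  2 ^ q * 2 ^ q        ≡⟨ ^-distribˡ-+-* 2 q q ⟨
  2 ^ (q + q)          ∎)
  where
  open ≤-Reasoning
  q = a + 2 * b + 1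
  identity : ∀ a b q → a + b * (q + q) + (a * q + q + 1 + 2 * b) ≡ (a + 2 * b + 1) * suc q
  identity = solve-∀

size-bound : ∀ j → suc (30 * (suc (2 ^ j) * suc (2 ^ j))) ≤ 2 ^ (7 + (j + j))
size-bound j = begin
  suc (30 * (suc N * suc N))      ≤⟨ s≤s (*-monoʳ-≤ 30 (*-mono-≤ suc≤ suc≤)) ⟩
  suc (30 * ((N + N) * (N + N)))  ≤⟨ +-monoˡ-≤ _ (m^n>0 2 (j + j)) ⟩
  2 ^ (j + j) + 30 * ((N + N) * (N + N)) ≡⟨ cong (_+ 30 * ((N + N) * (N + N)))
                                               (^-distribˡ-+-* 2 j j) ⟩
  -- The coefficients 1, 120 and 7 add up to 128, the seventh power of 2.
  N * N + 30 * ((N + N) * (N + N)) ≤⟨ m≤m+n _ (7 * (N * N)) ⟩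
  N * N + 30 * ((N + N) * (N + N)) + 7 * (N * N) ≡⟨ identity N ⟩
  128 * (N * N)                   ≡⟨ cong (128 *_) (^-distribˡ-+-* 2 j j) ⟨
  128 * 2 ^ (j + j)               ≡⟨ ^-distribˡ-+-* 2 7 (j + j) ⟨
  2 ^ (7 + (j + j))               ∎
  where
  open ≤-Reasoning
  N = 2 ^ j
  suc≤ : suc N ≤ N + N
  suc≤ = +-monoˡ-≤ N (m^n>0 2 j)
  identity : ∀ N → N * N + 30 * ((N + N) * (N + N)) + 7 * (N * N) ≡ 128 * (N * N)
  identity = solve-∀

eval-mono : ∀ p {m n} → m ≤ n → eval p m ≤ eval p n
eval-mono []      m≤n = z≤n
eval-mono (a ∷ p) m≤n = +-monoʳ-≤ a (*-mono-≤ m≤n (eval-mono p m≤n))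

-- With `suc l` equal to `2 ^ j`, both sides are compared as powers of 2: one exponent is linear in
-- j, the other is `2 ^ j` minus one.
exponential-beats : ∀ p → ∃[ l ] eval p (30 * (suc (suc l) * suc (suc l))) < 2 ^ l
exponential-beats p = l , (begin-strict
  eval p m                                   ≤⟨ eval≤ p m ⟩
  sum p * suc m ^ d                          ≤⟨ *-mono-≤ (<⇒≤ (n<2^n (sum p))) (^-monoˡ-≤ d bound) ⟩
  2 ^ sum p * (2 ^ (7 + (j + j))) ^ d        ≡⟨ cong (2 ^ sum p *_) (^-*-assoc 2 (7 + (j + j)) d) ⟩
  2 ^ sum p * 2 ^ ((7 + (j + j)) * d)        ≡⟨ ^-distribˡ-+-* 2 (sum p) _ ⟨
  2 ^ (sum p + (7 + (j + j)) * d)            <⟨ ^-monoʳ-< 2 (s≤s (s≤s z≤n)) exponent ⟩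
  2 ^ l                                      ∎)
  where
  open ≤-Reasoning
  d = length p
  -- The `suc` compensates for l being one less than `2 ^ j`.
  j = proj₁ (linear<2^ (suc (sum p + 7 * d)) (2 * d))
  l = pred (2 ^ j)
  m = 30 * (suc (suc l) * suc (suc l))
  suc-l : suc l ≡ 2 ^ j
  suc-l = suc-pred (2 ^ j) {{m^n≢0 2 j}}
  bound : suc m ≤ 2 ^ (7 + (j + j))
  bound = subst (λ N → suc (30 * (suc N * suc N)) ≤ 2 ^ (7 + (j + j))) (sym suc-l) (size-bound j)
  identity : ∀ s d j → suc (s + 7 * d) + 2 * d * j ≡ suc (s + (7 + (j + j)) * d)
  identity = solve-∀
  exponent : sum p + (7 + (j + j)) * d < l
  exponent = s≤s⁻¹ (subst₂ _<_ (identity (sum p) d j) (sym suc-l)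
                     (proj₂ (linear<2^ (suc (sum p + 7 * d)) (2 * d))))

-- Separation of the proof systems

-- The path is the root alone and nothing is touched, so `L = suc l` leaves room for l free answers
-- under the strict `budget`.
initial : ∀ l → Adversary (suc l) l
initial l = record
  { α = α₀ ; depth = 0 ; touched = []
  ; on = λ { k z≤n → refl } ; off = λ {i} {a} y _ → only-root {i} {a} y
  ; room = λ _ → z≤n ; budget = ≤-refl }
  where
  α₀ : Variable → Bool
  α₀ (half _ zero zero) = true
  α₀ _                  = false
  only-root : ∀ {i a} → α₀ (half false i a) ≡ true → i ≤ 0 × a ≡ position (α₀ ∘ switch) i
  only-root {zero} {zero} _ = z≤n , refl

not-simulated : ∀ P → (∀ L → P (formula L) (steps L)) → ¬ (TreeRes Simulates P)
not-simulated P upper (p , simulates) = too-small (exponential-beats p)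
  where
  open ≤-Reasoning
  too-small : ¬ (∃[ l ] eval p (30 * (suc (suc l) * suc (suc l))) < 2 ^ l)
  too-small (l , small) = absurd
    (simulates (formula L) (formula-unsatisfiable L) (steps L) (upper L))
    where
    L = suc l
    absurd : ¬ (∃[ t ] t ≤ eval p (steps L + ∣ formula L ∣) × TreeRes (formula L) t)
    absurd (_ , t≤ , π , refl) = <-irrefl refl (begin-strict
      2 ^ l                              ≤⟨ 2^r≤nodes (formula-occurs L) π (initial l) [] ⟩
      nodes π                            ≤⟨ t≤ ⟩
      eval p (steps L + ∣ formula L ∣)   ≤⟨ eval-mono p (size≤ L) ⟩
      eval p (30 * (suc L * suc L))      <⟨ small ⟩
      2 ^ l                              ∎)

refutation-map : ∀ {S T : MultiSet → MultiSet → Set} → (∀ {F G} → S F G → T F G) →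
                 ∀ {F s} → Refutation S F s → Refutation T F s
refutation-map f (done □∈)  = done □∈
refutation-map f (step s π) = step (f s) (refutation-map f π)

maxRes-refutes : ∀ L → MaxRes (formula L) (steps L)
maxRes-refutes L = subst (λ F → Refutation MaxResolution F (steps L)) (++-identityʳ _) (refute L [])

theorem3p8 : ¬ (TreeRes Simulates MaxRes) × ¬ (TreeRes Simulates MaxResW)
theorem3p8 = not-simulated MaxRes maxRes-refutes ,
             not-simulated MaxResW (refutation-map inj₁ ∘ maxRes-refutes)
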